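{- Let $c, d \in \mathbb{Z}$ with $d \ge 2$, and let $S_{d,c}$ be the set of primes $p$ such that the map induced by $\phi(x) = x^d + c$ on $\mathbb{Z}/p\mathbb{Z}$ consists of a single $p$-cycle. If $d \equiv 3 \pmod 4$ and $p$ is a prime with $p \equiv 1 \pmod 4$, then $p \notin S_{d,c}$.
   Context: For a prime $p$, the polynomial $\phi \in \mathbb{Z}[x]$ induces a map $\phi: \mathbb{Z}/p\mathbb{Z} \to \mathbb{Z}/p\mathbb{Z}$. "Consists of a single $p$-cycle" means that this map is a permutation of the $p$ elements of $\mathbb{Z}/p\mathbb{Z}$ that is a cycle of length $p$ (equivalently, $0$ is periodic with exact period $p$ modulo $p$). -}

module Defs where

open import Level using (0ℓ)
open import Data.Nat.Base using (ℕ; suc; NonZero)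
open import Data.Nat.DivMod using (_mod_)
open import Data.Nat.Primality using (Prime; prime⇒nonZero)
open import Data.Integer.Base using (ℤ; +_; _+_; _^_; _%ℕ_)
open import Data.Integer.DivMod using (n%ℕd<d)
open import Data.Fin.Base using (Fin; toℕ; fromℕ<)
open import Data.Product.Base using (Σ-syntax; _×_)
open import Function.Base using (_∘_)
open import Function.Definitions using (Injective; Bijective)
open import Relation.Binary.PropositionalEquality.Core using (_≡_; _≢_)
open import Relation.Unary using (Pred)

-- ℤ/nℤ is Fin n: each class is given by its representative in {0, …, n-1}.

residue : (n : ℕ) → .{{_ : NonZero n}} → ℤ → Fin n
residue n x = fromℕ< (n%ℕd<d x n)

-- Evaluates f at the standard representative.  This is the induced map only
-- when f respects congruence mod n, as every integer polynomial function does.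
induced : (n : ℕ) → .{{_ : NonZero n}} → (ℤ → ℤ) → Fin n → Fin n
induced n f = residue n ∘ f ∘ +_ ∘ toℕ

φ : ℕ → ℤ → ℤ → ℤ
φ d c x = x ^ d + c

-- f is the cycle (a₀ a₁ … aₖ₋₁): the aᵢ are distinct, f sends aᵢ to aᵢ₊₁ with
-- indices mod k, and f fixes everything else.
IsCycle : {A : Set} (k : ℕ) → .{{_ : NonZero k}} → (A → A) → Set
IsCycle {A} k f = Σ[ a ∈ (Fin k → A) ]
  ( Injective _≡_ _≡_ a
  × (∀ i → f (a i) ≡ a (suc (toℕ i) mod k))
  × (∀ x → (∀ i → a i ≢ x) → f x ≡ x))

ConsistsOfSingleCycle : (n : ℕ) → .{{_ : NonZero n}} → (Fin n → Fin n) → Set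
ConsistsOfSingleCycle n f = Bijective _≡_ _≡_ f × IsCycle n f

S : ℕ → ℤ → Pred ℕ 0ℓ
S d c p = Σ[ p-prime ∈ Prime p ]
  (let instance p≢0 = prime⇒nonZero p-prime
   in ConsistsOfSingleCycle p (induced p (φ d c)))

{-# OPTIONS --safe #-}
module Submission where

-- Modulo p, the ratio of the Vandermonde products of f(x₁), …, f(xₚ) and of x₁, …, xₚ is the
-- sign of the permutation f, whatever the ordering x₁, …, xₚ of the residues.  Order them along
-- the orbit of x ↦ x^d + c: translating by c changes no difference, so applying x ↦ x^d rotates
-- the list by one place as far as the product is concerned, and the sign is 1 since p is odd.
-- In the order 0, 1, -1, …, m, -m with p = 2m + 1, the product is a constant times
-- (m!)³ ∏ (i² - j²)² over i < j ≤ m.  The last factor is invariant under x ↦ x^d, which permutes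
-- the nonzero squares, while (m!)² = -1 by Wilson's theorem (m is even), so that
-- (m!)^d = -m! because d ≡ 3 (mod 4).  Hence the sign is also -1.

open import Defs
open import Level using (0ℓ)
import Algebra.Properties.CommutativeSemigroup as CommutativeSemigroup
open import Algebra.Bundles using (CommutativeMonoid)
open import Data.Nat.Base using (ℕ; zero; suc; _≥_; _%_)
import Data.Nat.Base as ℕ
import Data.Nat.Divisibility as ℕ
import Data.Nat.DivMod as ℕ
import Data.Nat.Properties as ℕ
import Data.Nat.Tactic.RingSolver as ℕ-solver
open import Data.Empty using (⊥)
open import Data.Fin.Base using (Fin; toℕ)
open import Data.Fin.Properties using (toℕ-injective; toℕ-fromℕ<; toℕ<n)
open import Data.Nat.Primality using (Prime; euclidsLemma; ¬prime[1]; prime⇒nonZero)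
open import Data.Integer.Base hiding (suc; _≥_; _%_)
open import Data.Integer.Properties
open import Data.Integer.Divisibility.Signed
open import Data.Integer.DivMod using (n%ℕd<d; a≡a%ℕn+[a/ℕn]*n)
open import Data.Integer.Tactic.RingSolver using (solve-∀)
open import Data.List.Base
  using (List; []; _∷_; _∷ʳ_; _++_; map; foldr; length; applyUpTo)
open import Data.List.Properties
  using (map-id; map-∘; map-cong; length-map; length-applyUpTo; applyUpTo-∷ʳ)
open import Data.List.Relation.Unary.All using (All; []; _∷_)
open import Data.List.Relation.Unary.All.Properties using (All¬⇒¬Any; ¬Any⇒All¬)
open import Data.List.Relation.Unary.AllPairs using ([]; _∷_)
open import Data.List.Relation.Unary.Any using (here; there)
open import Data.List.Relation.Binary.Pointwise as Pointwise using (Pointwise; []; _∷_)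
open import Data.Product.Base using (∃; _×_; _,_; proj₁; proj₂)
open import Data.Sum.Base as Sum using (_⊎_)
open import Function.Base using (id; _∘_)
open import Relation.Binary.Bundles using (Setoid)
open import Relation.Binary.Definitions using (tri<; tri≈; tri>)
import Data.List.Membership.Setoid as Membership
import Data.List.Membership.Setoid.Properties as Membershipₚ
import Data.List.Relation.Binary.Permutation.Setoid as Permutation
import Data.List.Relation.Binary.Permutation.Setoid.Properties as Permutationₚ
import Data.List.Relation.Unary.Unique.Setoid as Unique
import Data.List.Relation.Unary.Unique.Setoid.Properties as Uniqueₚ
import Relation.Binary.Reasoning.Setoid as ≈-Reasoning
open import Relation.Binary.PropositionalEquality
  using (_≡_; refl; sym; trans; cong; cong₂; subst; module ≡-Reasoning)
open import Relation.Nullary.Decidable.Core using (yes; no)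
open import Relation.Nullary.Negation using (¬_; contradiction)
open import Relation.Unary using (_∉_)

open CommutativeSemigroup *-commutativeSemigroup using (interchange; x∙yz≈y∙xz)

-- Products and Vandermonde products over lists

^-distribʳ-* : ∀ n x y → (x * y) ^ n ≡ x ^ n * y ^ n
^-distribʳ-* zero    x y = refl
^-distribʳ-* (suc n) x y = trans (cong (x * y *_) (^-distribʳ-* n x y)) (interchange x y (x ^ n) (y ^ n))

prod : List ℤ → ℤ
prod = foldr _*_ 1ℤ

-- Each pair is taken once, with the earlier entry as first argument, so the value depends on the
-- order of the list unless `k` is symmetric.
pairProd : (ℤ → ℤ → ℤ) → List ℤ → ℤ
pairProd k []       = 1ℤ
pairProd k (x ∷ xs) = prod (map (k x) xs) * pairProd k xs

vandermonde : List ℤ → ℤ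
vandermonde = pairProd _-_

-- The square of `vandermonde`, written with a symmetric factor for each pair so that its
-- independence of the order is an instance of `pairProd-resp-↭`.
discriminant : List ℤ → ℤ
discriminant = pairProd (λ x y → (x - y) * (x - y))

square : ℤ → ℤ
square x = x * x

-- Each entry is followed at once by its negative, so that inductions peel off `x` and `- x`
-- together and odd functions preserve the shape.
signed : List ℤ → List ℤ
signed []       = []
signed (x ∷ xs) = x ∷ - x ∷ signed xs

prod-∷ʳ : ∀ xs x → prod (xs ∷ʳ x) ≡ x * prod xs
prod-∷ʳ []       x = refl
prod-∷ʳ (y ∷ xs) x = trans (cong (y *_) (prod-∷ʳ xs x)) (x∙yz≈y∙xz y x (prod xs))

prod-map-* : ∀ (f g : ℤ → ℤ) xs →
  prod (map (λ x → f x * g x) xs) ≡ prod (map f xs) * prod (map g xs)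
prod-map-* f g []       = refl
prod-map-* f g (x ∷ xs) = trans (cong (f x * g x *_) (prod-map-* f g xs))
  (interchange (f x) (g x) (prod (map f xs)) (prod (map g xs)))

prod-map-neg : ∀ (f : ℤ → ℤ) xs → prod (map (-_ ∘ f) xs) ≡ -1ℤ ^ length xs * prod (map f xs)
prod-map-neg f []       = refl
prod-map-neg f (x ∷ xs) = trans (cong (- f x *_) (prod-map-neg f xs)) 
    (swap (f x) (-1ℤ ^ length xs) (prod (map f xs)))
  where
  swap : ∀ a b c → - a * (b * c) ≡ -1ℤ * b * (a * c)
  swap = solve-∀

prod-map-^ : ∀ d xs → prod (map (_^ d) xs) ≡ prod xs ^ d
prod-map-^ d []       = sym (^-zeroˡ d)
prod-map-^ d (x ∷ xs) = trans (cong (x ^ d *_) (prod-map-^ d xs)) (sym (^-distribʳ-* d x (prod xs)))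

pairProd-* : ∀ k l xs → pairProd (λ x y → k x y * l x y) xs ≡ pairProd k xs * pairProd l xs
pairProd-* k l []       = refl
pairProd-* k l (x ∷ xs) =
  trans (cong₂ _*_ (prod-map-* (k x) (l x) xs) (pairProd-* k l xs)) 
    (interchange (prod (map (k x) xs)) (prod (map (l x) xs)) (pairProd k xs) (pairProd l xs))

pairProd-map : ∀ k (f : ℤ → ℤ) xs → pairProd k (map f xs) ≡ pairProd (λ x y → k (f x) (f y)) xs
pairProd-map k f []       = refl
pairProd-map k f (x ∷ xs) = cong₂ _*_ (cong prod (sym (map-∘ xs))) (pairProd-map k f xs)

vandermonde-∷ʳ : ∀ xs x → vandermonde (xs ∷ʳ x) ≡ prod (map (_- x) xs) * vandermonde xs
vandermonde-∷ʳ []       x = refl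
vandermonde-∷ʳ (y ∷ xs) x = begin
  prod (map (_-_ y) (xs ∷ʳ x)) * vandermonde (xs ∷ʳ x)
    ≡⟨ cong₂ _*_ (trans (cong prod (map-∷ʳ xs)) (prod-∷ʳ (map (_-_ y) xs) (y - x))) (vandermonde-∷ʳ xs x) ⟩
  (y - x) * prod (map (_-_ y) xs) * (prod (map (_- x) xs) * vandermonde xs)
    ≡⟨ interchange (y - x) (prod (map (_-_ y) xs)) (prod (map (_- x) xs)) (vandermonde xs) ⟩
  (y - x) * prod (map (_- x) xs) * (prod (map (_-_ y) xs) * vandermonde xs) ∎
  where
  open ≡-Reasoning
  map-∷ʳ : ∀ zs → map (_-_ y) (zs ∷ʳ x) ≡ map (_-_ y) zs ∷ʳ (y - x)
  map-∷ʳ []       = refl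
  map-∷ʳ (z ∷ zs) = cong (_ ∷_) (map-∷ʳ zs)

-- Moving `x` from the front to the back reverses its difference with every entry of `xs`, and an
-- even number of sign changes cancels.
vandermonde-rotate : ∀ x xs → -1ℤ ^ length xs ≡ 1ℤ → vandermonde (xs ∷ʳ x) ≡ vandermonde (x ∷ xs)
vandermonde-rotate x xs even = trans (vandermonde-∷ʳ xs x) (cong (_* vandermonde xs) (begin
  prod (map (_- x) xs)                       ≡⟨ cong prod (map-cong (λ y → flip-sign y x) xs) ⟩
  prod (map (-_ ∘ (_-_ x)) xs)                ≡⟨ prod-map-neg (_-_ x) xs ⟩
  -1ℤ ^ length xs * prod (map (_-_ x) xs)     ≡⟨ cong (_* prod (map (_-_ x) xs)) even ⟩
  1ℤ * prod (map (_-_ x) xs)                  ≡⟨ *-identityˡ _ ⟩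
  prod (map (_-_ x) xs)                       ∎))
  where
  open ≡-Reasoning
  flip-sign : ∀ a b → a - b ≡ - (b - a)
  flip-sign = solve-∀

-- Lists closed under negation

length-signed : ∀ xs → length (signed xs) ≡ length xs ℕ.+ length xs
length-signed []       = refl
length-signed (x ∷ xs) = cong suc (trans (cong suc (length-signed xs)) (sym (ℕ.+-suc _ _)))

map-signed : ∀ (f : ℤ → ℤ) → (∀ x → f (- x) ≡ - f x) → ∀ xs → map f (signed xs) ≡ signed (map f xs)
map-signed f odd []       = refl
map-signed f odd (x ∷ xs) = cong₂ (λ y ys → f x ∷ y ∷ ys) (odd x) (map-signed f odd xs)

-- For the list 1, ..., m the left side is the product of the nonzero residues modulo 2m + 1, so
-- this links Wilson's theorem to (m!)².
prod-signed : ∀ xs → prod (signed xs) ≡ -1ℤ ^ length xs * (prod xs * prod xs)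
prod-signed []       = refl
prod-signed (x ∷ xs) =
  trans (cong (λ P → x * (- x * P)) (prod-signed xs)) (swap x (-1ℤ ^ length xs) (prod xs))
  where
  swap : ∀ a s P → a * (- a * (s * (P * P))) ≡ -1ℤ * s * (a * P * (a * P))
  swap = solve-∀

prod-map-0-signed : ∀ xs → prod (map (_-_ 0ℤ) (signed xs)) ≡ prod (signed xs)
prod-map-0-signed []       = refl
prod-map-0-signed (x ∷ xs) =
  trans (cong (λ P → (0ℤ - x) * ((0ℤ - - x) * P)) (prod-map-0-signed xs)) (swap x (prod (signed xs)))
  where
  swap : ∀ a P → (0ℤ - a) * ((0ℤ - - a) * P) ≡ a * (- a * P)
  swap = solve-∀

-- For each `y`, the four factors (x - y)(x + y)(-x - y)(-x + y) multiply to (x² - y²)².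
prod-differences-signed : ∀ x ys →
  prod (map (_-_ x) (signed ys)) * prod (map (_-_ (- x)) (signed ys)) ≡
  prod (map (λ v → (square x - v) * (square x - v)) (map square ys))
prod-differences-signed x []       = refl
prod-differences-signed x (y ∷ ys) =
  trans (swap x y _ _) (cong ((x * x - y * y) * (x * x - y * y) *_) (prod-differences-signed x ys))
  where
  swap : ∀ x y P Q → (x - y) * ((x - - y) * P) * ((- x - y) * ((- x - - y) * Q)) ≡
                     (x * x - y * y) * (x * x - y * y) * (P * Q)
  swap = solve-∀

-- The pair `x`, `- x` contributes 2x; the differences of both with the later entries combine into
-- squared differences of squares.
vandermonde-signed : ∀ xs →
  vandermonde (signed xs) ≡ (+ 2) ^ length xs * prod xs * discriminant (map square xs)
vandermonde-signed []       = refl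
vandermonde-signed (x ∷ xs) = begin
  (x - - x) * P * (Q * vandermonde (signed xs))
    ≡⟨ cong (λ V → (x - - x) * P * (Q * V)) (vandermonde-signed xs) ⟩
  (x - - x) * P * (Q * ((+ 2) ^ length xs * prod xs * D))
    ≡⟨ swap x P Q ((+ 2) ^ length xs) (prod xs) D ⟩
  + 2 * (+ 2) ^ length xs * (x * prod xs) * (P * Q * D)
    ≡⟨ cong (λ z → + 2 * (+ 2) ^ length xs * (x * prod xs) * (z * D)) (prod-differences-signed x xs) ⟩
  + 2 * (+ 2) ^ length xs * (x * prod xs) * discriminant (map square (x ∷ xs)) ∎
  where
  open ≡-Reasoning
  P = prod (map (_-_ x) (signed xs))
  Q = prod (map (_-_ (- x)) (signed xs))
  D = discriminant (map square xs)
  swap : ∀ x P Q t c D → (x - - x) * P * (Q * (t * c * D)) ≡ + 2 * t * (x * c) * (P * Q * D)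
  swap = solve-∀

vandermonde-0∷signed : ∀ xs → vandermonde (0ℤ ∷ signed xs) ≡
  -1ℤ ^ length xs * (+ 2) ^ length xs * (prod xs * prod xs * prod xs * discriminant (map square xs))
vandermonde-0∷signed xs = trans
  (cong₂ _*_ (trans (prod-map-0-signed xs) (prod-signed xs)) (vandermonde-signed xs))
  (swap (-1ℤ ^ length xs) (prod xs) ((+ 2) ^ length xs) (discriminant (map square xs)))
  where
  swap : ∀ s c t D → s * (c * c) * (t * c * D) ≡ s * t * (c * c * c * D)
  swap = solve-∀

-- Congruence modulo n

module Congruence (n : ℕ) where

  infix 4 _≈_

  -- A record, so that x and y can be inferred from x ≈ y.
  record _≈_ (x y : ℤ) : Set where
    constructor congruent
    field difference : + n ∣ x - y

  open _≈_ public

  private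
    via : ∀ {x y z} → z ≡ x - y → + n ∣ z → x ≈ y
    via eq n∣z = congruent (subst (+ n ∣_) eq n∣z)

  ≈-reflexive : ∀ {x y} → x ≡ y → x ≈ y
  ≈-reflexive {x} refl = via (sym (+-inverseʳ x)) (divides 0ℤ refl)

  ≈-sym : ∀ {x y} → x ≈ y → y ≈ x
  ≈-sym {x} {y} x≈y = via (eq x y) (∣m⇒∣-m (difference x≈y))
    where
    eq : ∀ x y → - (x - y) ≡ y - x
    eq = solve-∀

  ≈-trans : ∀ {x y z} → x ≈ y → y ≈ z → x ≈ z
  ≈-trans {x} {y} {z} x≈y y≈z = via (eq x y z) (∣m∣n⇒∣m+n (difference x≈y) (difference y≈z))
    where
    eq : ∀ x y z → (x - y) + (y - z) ≡ x - z
    eq = solve-∀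

  ≈-setoid : Setoid 0ℓ 0ℓ
  ≈-setoid = record
    { _≈_ = _≈_
    ; isEquivalence = record { refl = ≈-reflexive refl ; sym = ≈-sym ; trans = ≈-trans }
    }

  ≈-refl : ∀ {x} → x ≈ x
  ≈-refl = ≈-reflexive refl

  +-cong : ∀ {x x′ y y′} → x ≈ x′ → y ≈ y′ → x + y ≈ x′ + y′
  +-cong {x} {x′} {y} {y′} x≈x′ y≈y′ =
    via (eq x x′ y y′) (∣m∣n⇒∣m+n (difference x≈x′) (difference y≈y′))
    where
    eq : ∀ x x′ y y′ → (x - x′) + (y - y′) ≡ (x + y) - (x′ + y′)
    eq = solve-∀

  neg-cong : ∀ {x y} → x ≈ y → - x ≈ - y
  neg-cong {x} {y} x≈y = via (eq x y) (∣m⇒∣-m (difference x≈y))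
    where
    eq : ∀ x y → - (x - y) ≡ - x - - y
    eq = solve-∀

  -‿cong : ∀ {x x′ y y′} → x ≈ x′ → y ≈ y′ → x - y ≈ x′ - y′
  -‿cong x≈x′ y≈y′ = +-cong x≈x′ (neg-cong y≈y′)

  *-cong : ∀ {x x′ y y′} → x ≈ x′ → y ≈ y′ → x * y ≈ x′ * y′
  *-cong {x} {x′} {y} {y′} x≈x′ y≈y′ = via (eq x x′ y y′)
    (∣m∣n⇒∣m+n (∣m⇒∣m*n y (difference x≈x′)) (∣n⇒∣m*n x′ (difference y≈y′)))
    where
    eq : ∀ x x′ y y′ → (x - x′) * y + x′ * (y - y′) ≡ x * y - x′ * y′
    eq = solve-∀

  *-congˡ : ∀ x {y y′} → y ≈ y′ → x * y ≈ x * y′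
  *-congˡ x = *-cong {x} ≈-refl

  ^-cong : ∀ d {x y} → x ≈ y → x ^ d ≈ y ^ d
  ^-cong zero    x≈y = ≈-refl
  ^-cong (suc d) x≈y = *-cong x≈y (^-cong d x≈y)

  *-≈-commutativeMonoid : CommutativeMonoid 0ℓ 0ℓ
  *-≈-commutativeMonoid = record
    { isCommutativeMonoid = record
      { isMonoid = record
        { isSemigroup = record
          { isMagma = record
            { isEquivalence = Setoid.isEquivalence ≈-setoid
            ; ∙-cong = *-cong
            }
          ; assoc = λ x y z → ≈-reflexive (*-assoc x y z)
          }
        ; identity = (λ x → ≈-reflexive (*-identityˡ x)) , (λ x → ≈-reflexive (*-identityʳ x))
        }
      ; comm = λ x y → ≈-reflexive (*-comm x y)
      }
    }

  difference≈0⇒≈ : ∀ {x y} → x - y ≈ 0ℤ → x ≈ y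
  difference≈0⇒≈ {x} {y} x-y≈0 = via (+-identityʳ (x - y)) (difference x-y≈0)

  inverse-unique : ∀ {x y z} → x * z ≈ 1ℤ → y * z ≈ 1ℤ → x ≈ y
  inverse-unique {x} {y} {z} xz≈1 yz≈1 = begin
    x            ≡⟨ *-identityʳ x ⟨
    x * 1ℤ       ≈⟨ *-congˡ x yz≈1 ⟨
    x * (y * z)  ≡⟨ x∙yz≈y∙xz x y z ⟩
    y * (x * z)  ≈⟨ *-congˡ y xz≈1 ⟩
    y * 1ℤ       ≡⟨ *-identityʳ y ⟩
    y            ∎
    where open ≈-Reasoning ≈-setoid

  -- Lists of integers up to congruence and reordering

  open Membership ≈-setoid using () renaming (_∈_ to _∈ₗ_) public
  open Membershipₚ using (∈-∃++; ∈-resp-≈)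
  open Unique ≈-setoid using (Unique) public
  open Permutation ≈-setoid using (_↭_; ↭-sym; ↭-prep; prep; swap) public
  open Permutation ≈-setoid using (↭-trans; ↭-reflexive-≋)
  open Permutationₚ ≈-setoid using (shift; ∈-resp-↭; Unique-resp-↭; xs↭ys⇒|xs|≡|ys|; foldr-commMonoid)
  open CommutativeMonoid *-≈-commutativeMonoid using (isCommutativeMonoid)

  ∈⇒↭∷ : ∀ {x xs} → x ∈ₗ xs → ∃ λ ys → xs ↭ x ∷ ys
  ∈⇒↭∷ x∈xs with as , bs , w , x≈w , xs≋ ← ∈-∃++ ≈-setoid x∈xs =
    as ++ bs , ↭-trans (↭-reflexive-≋ xs≋) (shift (≈-sym x≈w) as bs)

  ∈-∷⁻ : ∀ {x y ys} → ¬ (x ≈ y) → x ∈ₗ y ∷ ys → x ∈ₗ ys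
  ∈-∷⁻ x≉y (here x≈y)   = contradiction x≈y x≉y
  ∈-∷⁻ x≉y (there x∈ys) = x∈ys

  head-≉ : ∀ {x y xs} → Unique (x ∷ xs) → y ∈ₗ xs → ¬ (x ≈ y)
  head-≉ (x≉xs ∷ _) y∈xs x≈y = All¬⇒¬Any x≉xs (∈-resp-≈ ≈-setoid (≈-sym x≈y) y∈xs)

  -- The pigeonhole principle. Removing the head of `xs` from both lists keeps the inclusion, since
  -- no later entry of `xs` is congruent to it, and the length bound leaves nothing of `ys` once
  -- `xs` is exhausted.
  Unique⇒↭ : ∀ {xs ys} → Unique xs → (∀ {x} → x ∈ₗ xs → x ∈ₗ ys) →
             length ys ℕ.≤ length xs → xs ↭ ys
  Unique⇒↭ {[]}     {[]} _ _ _ = Permutation.↭-refl ≈-setoid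
  Unique⇒↭ {x ∷ xs} {ys} xs!@(_ ∷ xs!′) xs⊆ys |ys|≤|xs|
    with zs , ys↭x∷zs ← ∈⇒↭∷ (xs⊆ys (here ≈-refl)) =
    ↭-trans (↭-prep x (Unique⇒↭ xs!′
      (λ y∈xs → ∈-∷⁻ (head-≉ xs! y∈xs ∘ ≈-sym) (∈-resp-↭ ys↭x∷zs (xs⊆ys (there y∈xs))))
      (ℕ.≤-pred (subst (ℕ._≤ _) (xs↭ys⇒|xs|≡|ys| ys↭x∷zs) |ys|≤|xs|))))
      (↭-sym ys↭x∷zs)

  prod-resp-↭ : ∀ {xs ys} → xs ↭ ys → prod xs ≈ prod ys
  prod-resp-↭ = foldr-commMonoid isCommutativeMonoid

  -- Products that cancel in inverse pairs

  Paired : List ℤ → Set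
  Paired xs = ∀ {x} → x ∈ₗ xs → ∃ λ y → y ∈ₗ xs × x * y ≈ 1ℤ × ¬ (x ≈ y)

  -- Inverses are unique: an entry of `zs` whose partner is `x` or `y` would be congruent to `y` or
  -- `x`, against distinctness.
  Paired-tail : ∀ {x y zs} → x * y ≈ 1ℤ → Unique (x ∷ y ∷ zs) → Paired (x ∷ y ∷ zs) → Paired zs
  Paired-tail {x} {y} {zs} xy≈1 x∷y∷zs!@(_ ∷ y∷zs!) partner {z} z∈zs =
    let w , w∈ , zw≈1 , z≉w = partner (there (there z∈zs))
    in  w , ∈-∷⁻ (w≉y zw≈1) (∈-∷⁻ (w≉x zw≈1) w∈) , zw≈1 , z≉w
    where
    w≉x : ∀ {w} → z * w ≈ 1ℤ → ¬ (w ≈ x)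
    w≉x zw≈1 w≈x = head-≉ y∷zs! z∈zs (inverse-unique {y} {z} {x}
      (≈-trans (≈-reflexive (*-comm y x)) xy≈1) (≈-trans (*-congˡ z (≈-sym w≈x)) zw≈1))
    w≉y : ∀ {w} → z * w ≈ 1ℤ → ¬ (w ≈ y)
    w≉y zw≈1 w≈y = head-≉ x∷y∷zs! (there z∈zs) (inverse-unique {x} {z} {y}
      xy≈1 (≈-trans (*-congˡ z (≈-sym w≈y)) zw≈1))

  Paired-resp-↭ : ∀ {xs ys} → xs ↭ ys → Paired xs → Paired ys
  Paired-resp-↭ xs↭ys partner z∈ys =
    let w , w∈xs , zw≈1 , z≉w = partner (∈-resp-↭ (↭-sym xs↭ys) z∈ys)
    in  w , ∈-resp-↭ xs↭ys w∈xs , zw≈1 , z≉w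

  -- The partner of the head may stand anywhere, so the list is reordered before both are removed;
  -- the bound `m` on the length keeps the recursion structural.
  prod-paired : ∀ m {xs} → length xs ℕ.≤ m → Unique xs → Paired xs → prod xs ≈ 1ℤ
  prod-paired m       {[]}     _     _   _ = ≈-refl
  prod-paired (suc m) {x ∷ xs} |xs|≤ xs! partner =
    let y , y∈ , xy≈1 , x≉y = partner (here ≈-refl)
        zs , xs↭y∷zs = ∈⇒↭∷ (∈-∷⁻ (x≉y ∘ ≈-sym) y∈)
        x∷xs↭ = ↭-prep x xs↭y∷zs
        x∷y∷zs! = Unique-resp-↭ x∷xs↭ xs!
    in begin
      x * prod xs       ≈⟨ *-congˡ x (prod-resp-↭ xs↭y∷zs) ⟩
      x * (y * prod zs) ≡⟨ *-assoc x y (prod zs) ⟨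
      x * y * prod zs   ≈⟨ *-cong xy≈1 (prod-paired m
        (ℕ.<⇒≤ (ℕ.≤-pred (subst (ℕ._≤ suc m) (xs↭ys⇒|xs|≡|ys| x∷xs↭) |xs|≤)))
        (Uniqueₚ.drop⁺ ≈-setoid 2 x∷y∷zs!)
        (Paired-tail xy≈1 x∷y∷zs! (Paired-resp-↭ x∷xs↭ partner))) ⟩
      1ℤ                ∎
    where open ≈-Reasoning ≈-setoid

  -- Pair products under congruence and reordering

  module _ {k : ℤ → ℤ → ℤ}
           (k-cong : ∀ {x x′ y y′} → x ≈ x′ → y ≈ y′ → k x y ≈ k x′ y′) where

    private
      row-cong : ∀ {x x′ xs ys} → x ≈ x′ → Pointwise _≈_ xs ys →
                 prod (map (k x) xs) ≈ prod (map (k x′) ys)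
      row-cong x≈x′ []            = ≈-refl
      row-cong x≈x′ (y≈y′ ∷ ys≋) = *-cong (k-cong x≈x′ y≈y′) (row-cong x≈x′ ys≋)

    pairProd-cong : ∀ {xs ys} → Pointwise _≈_ xs ys → pairProd k xs ≈ pairProd k ys
    pairProd-cong []            = ≈-refl
    pairProd-cong (x≈y ∷ xs≋ys) = *-cong (row-cong x≈y xs≋ys) (pairProd-cong xs≋ys)

    -- Swapping two neighbours exchanges their rows of factors and turns `k x y` into `k y x`; only
    -- the latter needs symmetry.
    pairProd-resp-↭ : (∀ x y → k x y ≡ k y x) → ∀ {xs ys} → xs ↭ ys → pairProd k xs ≈ pairProd k ys
    pairProd-resp-↭ k-comm = go
      where
      open ≈-Reasoning ≈-setoid
      row : ∀ {x x′ xs ys} → x ≈ x′ → xs ↭ ys → prod (map (k x) xs) ≈ prod (map (k x′) ys)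
      row {ys = ys} x≈x′ xs↭ys = ≈-trans
        (prod-resp-↭ (Permutationₚ.map⁺ ≈-setoid ≈-setoid (k-cong ≈-refl) xs↭ys))
        (row-cong {xs = ys} x≈x′ (Pointwise.refl ≈-refl))
      go : ∀ {xs ys} → xs ↭ ys → pairProd k xs ≈ pairProd k ys
      go (Permutation.refl xs≋ys)        = pairProd-cong xs≋ys
      go (prep x≈y xs↭ys)                = *-cong (row x≈y xs↭ys) (go xs↭ys)
      go (Permutation.trans xs↭ys ys↭zs) = ≈-trans (go xs↭ys) (go ys↭zs)
      go (swap {xs} {ys} {x} {y} {x′} {y′} x≈x′ y≈y′ xs↭ys) = begin
        k x y * prod (map (k x) xs) * (prod (map (k y) xs) * pairProd k xs)
          ≡⟨ interchange (k x y) (prod (map (k x) xs)) (prod (map (k y) xs)) (pairProd k xs) ⟩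
        k x y * prod (map (k y) xs) * (prod (map (k x) xs) * pairProd k xs)
          ≈⟨ *-cong (*-cong (≈-trans (≈-reflexive (k-comm x y)) (k-cong y≈y′ x≈x′)) (row y≈y′ xs↭ys))
                    (*-cong (row x≈x′ xs↭ys) (go xs↭ys)) ⟩
        k y′ x′ * prod (map (k y′) ys) * (prod (map (k x′) ys) * pairProd k ys) ∎

-- Translations and odd powers

vandermonde-translate : ∀ c xs → vandermonde (map (_+ c) xs) ≡ vandermonde xs
vandermonde-translate c []       = refl
vandermonde-translate c (x ∷ xs) = cong₂ _*_
  (cong prod (trans (sym (map-∘ xs)) (map-cong (λ y → cancel x y c) xs)))
  (vandermonde-translate c xs)
  where
  cancel : ∀ x y c → (x + c) - (y + c) ≡ x - y
  cancel = solve-∀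

-1^[n+n]≡1 : ∀ n → -1ℤ ^ (n ℕ.+ n) ≡ 1ℤ
-1^[n+n]≡1 n = begin
  -1ℤ ^ (n ℕ.+ n)   ≡⟨ ^-distribˡ-+-* -1ℤ n n ⟩
  -1ℤ ^ n * -1ℤ ^ n ≡⟨ ^-distribʳ-* n -1ℤ -1ℤ ⟨
  1ℤ ^ n            ≡⟨ ^-zeroˡ n ⟩
  1ℤ                ∎
  where open ≡-Reasoning

^-3+4* : ∀ x j → x ^ (3 ℕ.+ 4 ℕ.* j) ≡ x ^ 3 * (x ^ 4) ^ j
^-3+4* x j = trans (^-distribˡ-+-* x 3 (4 ℕ.* j)) (cong (x ^ 3 *_) (sym (^-*-assoc x 4 j)))

^-odd : ∀ j x → (- x) ^ (3 ℕ.+ 4 ℕ.* j) ≡ - x ^ (3 ℕ.+ 4 ℕ.* j)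
^-odd j x = begin
  (- x) ^ d          ≡⟨ cong (_^ d) (-1*i≡-i x) ⟨
  (-1ℤ * x) ^ d      ≡⟨ ^-distribʳ-* d -1ℤ x ⟩
  -- The third and fourth powers of -1 compute, so only a power of 1 remains to be removed.
  -1ℤ ^ d * x ^ d    ≡⟨ cong (_* x ^ d) (trans (^-3+4* -1ℤ j) (cong (-1ℤ *_) (^-zeroˡ j))) ⟩
  -1ℤ * x ^ d        ≡⟨ -1*i≡-i (x ^ d) ⟩
  - x ^ d            ∎
  where
  open ≡-Reasoning
  d = 3 ℕ.+ 4 ℕ.* j

∈-signed⁺ : ∀ {n x xs} → let open Congruence n in x ∈ₗ xs → x ∈ₗ signed xs × - x ∈ₗ signed xs
∈-signed⁺ {n} (here x≈y)   = here x≈y , there (here (Congruence.neg-cong n x≈y))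
∈-signed⁺     (there x∈xs) = let p , q = ∈-signed⁺ x∈xs in there (there p) , there (there q)

-- Standard representatives of the residue classes

module _ (n : ℕ) .{{_ : ℕ.NonZero n}} where

  open Congruence n

  %ℕ-≈ : ∀ z → z ≈ + (z %ℕ n)
  %ℕ-≈ z = congruent (divides (z /ℕ n) (begin
    z - + r               ≡⟨ cong (_- + r) (a≡a%ℕn+[a/ℕn]*n z n) ⟩
    + r + q * + n - + r   ≡⟨ cancel (+ r) (q * + n) ⟩
    q * + n               ∎))
    where
    open ≡-Reasoning
    r = z %ℕ n
    q = z /ℕ n
    cancel : ∀ a b → a + b - a ≡ b
    cancel = solve-∀

  +≉+ : ∀ {i j} → i ℕ.< j → j ℕ.< n → ¬ (+ i ≈ + j)
  +≉+ {i} {j} i<j j<n i≈j = ℕ.<⇒≱ j<n (ℕ.≤-trans n≤j∸i (ℕ.m∸n≤m j i))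
    where
    instance _ = ℕ.>-nonZero (ℕ.m<n⇒0<n∸m i<j)
    n≤j∸i : n ℕ.≤ j ℕ.∸ i
    n≤j∸i = ℕ.∣⇒≤ (subst (n ℕ.∣_) (trans (cong ∣_∣ ([+m]-[+n]≡m⊖n i j)) (∣⊖∣-< i<j))
      (∣⇒∣ᵤ (difference i≈j)))

  +-injective-< : ∀ {i j} → i ℕ.< n → j ℕ.< n → + i ≈ + j → i ≡ j
  +-injective-< {i} {j} i<n j<n i≈j with ℕ.<-cmp i j
  ... | tri< i<j _ _ = contradiction i≈j (+≉+ i<j j<n)
  ... | tri≈ _ i≡j _ = i≡j
  ... | tri> _ _ j<i = contradiction (≈-sym i≈j) (+≉+ j<i i<n)

  toℕ-≈-injective : ∀ {u v : Fin n} → + toℕ u ≈ + toℕ v → u ≡ v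
  toℕ-≈-injective {u} {v} = toℕ-injective ∘ +-injective-< (toℕ<n u) (toℕ<n v)

  ≈-residue : ∀ z → z ≈ + toℕ (residue n z)
  ≈-residue z = ≈-trans (%ℕ-≈ z) (≈-reflexive (cong +_ (sym (toℕ-fromℕ< (n%ℕd<d z n)))))

-- Vandermonde products along an orbit and under reordering

module _ {n : ℕ} where

  open Congruence n

  -- The orbit has m + 1 entries, and closing it up moves `b 0` past the other m; hence the parity
  -- condition is on m and not on the length.
  vandermonde-orbit : ∀ d c m (b : ℕ → ℤ) → -1ℤ ^ m ≡ 1ℤ →
    (∀ i → b i ^ d + c ≈ b (suc i)) → b (suc m) ≡ b 0 →
    vandermonde (map (_^ d) (applyUpTo b (suc m))) ≈ vandermonde (applyUpTo b (suc m))
  vandermonde-orbit d c m b even step closed = begin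
    vandermonde (map (_^ d) A)
      ≡⟨ vandermonde-translate c (map (_^ d) A) ⟨
    vandermonde (map (_+ c) (map (_^ d) A))
      ≡⟨ cong vandermonde (map-∘ A) ⟨
    vandermonde (map (λ x → x ^ d + c) A)
      ≈⟨ pairProd-cong -‿cong (shifted b step (suc m)) ⟩
    vandermonde (applyUpTo (b ∘ suc) (suc m))
      ≡⟨ cong vandermonde (applyUpTo-∷ʳ (b ∘ suc) m) ⟨
    vandermonde (applyUpTo (b ∘ suc) m ∷ʳ b (suc m))
      ≡⟨ cong (λ x → vandermonde (applyUpTo (b ∘ suc) m ∷ʳ x)) closed ⟩
    vandermonde (applyUpTo (b ∘ suc) m ∷ʳ b 0)
      ≡⟨ vandermonde-rotate (b 0) (applyUpTo (b ∘ suc) m)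
           (trans (cong (-1ℤ ^_) (length-applyUpTo (b ∘ suc) m)) even) ⟩
    vandermonde A ∎
    where
    open ≈-Reasoning ≈-setoid
    A = applyUpTo b (suc m)
    shifted : ∀ b → (∀ i → b i ^ d + c ≈ b (suc i)) → ∀ m →
              Pointwise _≈_ (map (λ x → x ^ d + c) (applyUpTo b m)) (applyUpTo (b ∘ suc) m)
    shifted b step zero    = []
    shifted b step (suc m) = step 0 ∷ shifted (b ∘ suc) (step ∘ suc) m

  discriminant-resp-↭ : ∀ {xs ys} → xs ↭ ys → discriminant xs ≈ discriminant ys
  discriminant-resp-↭ = pairProd-resp-↭
    (λ x≈x′ y≈y′ → *-cong (-‿cong x≈x′ y≈y′) (-‿cong x≈x′ y≈y′)) comm
    where
    comm : ∀ x y → (x - y) * (x - y) ≡ (y - x) * (y - x)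
    comm = solve-∀

  -- For a permutation f of the entries, the product is the sign of f times the discriminant.
  vandermonde-*-resp-↭ : ∀ {f} → (∀ {x y} → x ≈ y → f x ≈ f y) → ∀ {xs ys} → xs ↭ ys →
    vandermonde (map f xs) * vandermonde xs ≈ vandermonde (map f ys) * vandermonde ys
  vandermonde-*-resp-↭ {f} f-cong {xs} {ys} xs↭ys = begin
    vandermonde (map f xs) * vandermonde xs           ≡⟨ split xs ⟨
    pairProd (λ x y → (f x - f y) * (x - y)) xs
      ≈⟨ pairProd-resp-↭
           (λ x≈x′ y≈y′ → *-cong (-‿cong (f-cong x≈x′) (f-cong y≈y′)) (-‿cong x≈x′ y≈y′))
           (λ x y → comm x y (f x) (f y)) xs↭ys ⟩
    pairProd (λ x y → (f x - f y) * (x - y)) ys       ≡⟨ split ys ⟩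
    vandermonde (map f ys) * vandermonde ys           ∎
    where
    open ≈-Reasoning ≈-setoid
    comm : ∀ x y a b → (a - b) * (x - y) ≡ (b - a) * (y - x)
    comm = solve-∀
    split : ∀ xs → pairProd (λ x y → (f x - f y) * (x - y)) xs ≡ vandermonde (map f xs) * vandermonde xs
    split xs = trans (pairProd-* (λ x y → f x - f y) _-_ xs)
      (cong (_* vandermonde xs) (sym (pairProd-map _-_ f xs)))

-- Arithmetic modulo a prime

module PrimeModulus {p : ℕ} (p-prime : Prime p) where

  open Congruence p
  open ≈-Reasoning ≈-setoid

  *-≈0 : ∀ x y → x * y ≈ 0ℤ → x ≈ 0ℤ ⊎ y ≈ 0ℤ
  *-≈0 x y xy≈0 = Sum.map to≈0 to≈0
    (euclidsLemma ∣ x ∣ ∣ y ∣ p-prime (subst (p ℕ.∣_) (trans (cong ∣_∣ (+-identityʳ (x * y))) (abs-* x y))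
      (∣⇒∣ᵤ (difference xy≈0))))
    where
    to≈0 : ∀ {z} → p ℕ.∣ ∣ z ∣ → z ≈ 0ℤ
    to≈0 {z} p∣z = congruent (subst (+ p ∣_) (sym (+-identityʳ z)) (∣ᵤ⇒∣ p∣z))

  *-≉0 : ∀ {x y} → ¬ (x ≈ 0ℤ) → ¬ (y ≈ 0ℤ) → ¬ (x * y ≈ 0ℤ)
  *-≉0 {x} {y} x≉0 y≉0 xy≈0 = Sum.[ x≉0 , y≉0 ] (*-≈0 x y xy≈0)

  *-cancelʳ-≈ : ∀ x y z → ¬ (z ≈ 0ℤ) → x * z ≈ y * z → x ≈ y
  *-cancelʳ-≈ x y z z≉0 xz≈yz = Sum.[ difference≈0⇒≈ , (λ z≈0 → contradiction z≈0 z≉0) ]′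
    (*-≈0 (x - y) z (begin
      (x - y) * z    ≡⟨ distrib x y z ⟩
      x * z - y * z  ≈⟨ -‿cong xz≈yz ≈-refl ⟩
      y * z - y * z  ≡⟨ +-inverseʳ (y * z) ⟩
      0ℤ             ∎))
    where
    distrib : ∀ x y z → (x - y) * z ≡ x * z - y * z
    distrib = solve-∀

  square-injective : ∀ x y → square x ≈ square y → x ≈ y ⊎ x ≈ - y
  square-injective x y x²≈y² = Sum.map difference≈0⇒≈
    (λ eq → difference≈0⇒≈ (≈-trans (≈-reflexive (cong (_+_ x) (neg-involutive y))) eq))
    (*-≈0 (x - y) (x + y) (begin
      (x - y) * (x + y)    ≡⟨ factor x y ⟩
      x * x - y * y        ≈⟨ -‿cong x²≈y² ≈-refl ⟩
      y * y - y * y        ≡⟨ +-inverseʳ (y * y) ⟩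
      0ℤ                   ∎))
    where
    factor : ∀ x y → (x - y) * (x + y) ≡ x * x - y * y
    factor = solve-∀

  1≉0 : ¬ (1ℤ ≈ 0ℤ)
  1≉0 1≈0 = ¬prime[1] (subst Prime (ℕ.∣1⇒≡1 (∣⇒∣ᵤ (difference 1≈0))) p-prime)

  -- A product of nonzero differences, and there are no zero divisors modulo a prime.
  vandermonde-≉0 : ∀ {xs} → Unique xs → ¬ (vandermonde xs ≈ 0ℤ)
  vandermonde-≉0 {[]}     _           = 1≉0
  vandermonde-≉0 {x ∷ xs} (x≉ ∷ xs!) = *-≉0 (row x≉) (vandermonde-≉0 xs!)
    where
    row : ∀ {ys} → All (λ y → ¬ (x ≈ y)) ys → ¬ (prod (map (_-_ x) ys) ≈ 0ℤ)
    row []          = 1≉0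
    row (x≉y ∷ x≉) = *-≉0 (x≉y ∘ difference≈0⇒≈) (row x≉)

  ∈-signed⁻ : ∀ {x ys} → x ∈ₗ signed ys → square x ∈ₗ map square ys
  ∈-signed⁻ {ys = y ∷ ys} (here x≈y)           = here (*-cong x≈y x≈y)
  ∈-signed⁻ {ys = y ∷ ys} (there (here x≈-y))  =
    here (≈-trans (*-cong x≈-y x≈-y) (≈-reflexive (square-neg y)))
    where
    square-neg : ∀ y → - y * - y ≡ y * y
    square-neg = solve-∀
  ∈-signed⁻ {ys = y ∷ ys} (there (there x∈)) = there (∈-signed⁻ x∈)

  -- Congruent squares force x ≡ y or x ≡ -y, and both `y` and `- y` occur in the signed list after
  -- `x`.
  Unique-squares : ∀ {xs} → Unique (signed xs) → Unique (map square xs)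
  Unique-squares {[]}     _                          = []
  Unique-squares {x ∷ xs} ±xs!@(_ ∷ _ ∷ ±xs!′) =
    ¬Any⇒All¬ _ x²∉ ∷ Unique-squares ±xs!′
    where
    x²∉ : ¬ (square x ∈ₗ map square xs)
    x²∉ x²∈ =
      let y , y∈xs , x²≈y² = Membershipₚ.∈-map⁻ ≈-setoid ≈-setoid x²∈
          y∈ , -y∈ = ∈-signed⁺ y∈xs
      in Sum.[ head-≉ ±xs! (there y∈) , head-≉ ±xs! (there -y∈) ] (square-injective x y x²≈y²)

-- The representatives 0, ±1, …, ±m for p = 2m + 1, where m = m′ + 1.
module SignedResidues {p m′ : ℕ} (p-prime : Prime p) (p≡1+2m : p ≡ suc (suc m′ ℕ.+ suc m′)) where

  open Congruence p
  open PrimeModulus p-prime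
  open ≈-Reasoning ≈-setoid

  m : ℕ
  m = suc m′

  half residues : List ℤ
  half     = applyUpTo (λ i → + suc i) m
  residues = 0ℤ ∷ signed half

  length-half : length half ≡ m
  length-half = length-applyUpTo (λ i → + suc i) m

  length-residues : length residues ≡ p
  length-residues = trans
    (cong suc (trans (length-signed half) (cong₂ ℕ._+_ length-half length-half))) (sym p≡1+2m)

  private instance
    p≢0 : ℕ.NonZero p
    p≢0 = prime⇒nonZero p-prime

  +suc∈half : ∀ {i} → i ℕ.< m → + suc i ∈ₗ half
  +suc∈half = Membershipₚ.∈-applyUpTo⁺ ≈-setoid (λ i → + suc i)

  +∈residues : ∀ r → r ℕ.< p → + r ∈ₗ residues
  +∈residues zero    _   = here ≈-refl
  +∈residues (suc i) i<p with i ℕ.<? m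
  ... | yes i<m = there (proj₁ (∈-signed⁺ (+suc∈half i<m)))
  ... | no  i≮m = there (Membershipₚ.∈-resp-≈ ≈-setoid (≈-sym ≈-neg) (proj₂ (∈-signed⁺ (+suc∈half j<m))))
    where
    -- Here i + 1 exceeds m, so it is represented by -(j + 1), with j chosen so that (i + 1) + (j +
    -- 1) = p.
    j = p ℕ.∸ suc (suc i)
    1+j+1+i≡p : suc j ℕ.+ suc i ≡ p
    1+j+1+i≡p = trans (sym (ℕ.+-suc j (suc i))) (ℕ.m∸n+n≡m i<p)
    j<m : j ℕ.< m
    j<m = ℕ.+-cancelʳ-≤ (suc m) (suc j) m (subst (suc j ℕ.+ suc m ℕ.≤_)
      (trans 1+j+1+i≡p (trans p≡1+2m (sym (ℕ.+-suc m m))))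
      (ℕ.+-monoʳ-≤ (suc j) (ℕ.s≤s (ℕ.≮⇒≥ i≮m))))
    ≈-neg : + suc i ≈ - + suc j
    ≈-neg = congruent (divides 1ℤ (trans (cong (_+_ (+ suc i)) (neg-involutive (+ suc j)))
      (trans (cong +_ (trans (ℕ.+-comm (suc i) (suc j)) 1+j+1+i≡p)) (sym (*-identityˡ (+ p))))))

  complete : ∀ z → z ∈ₗ residues
  complete z = Membershipₚ.∈-resp-≈ ≈-setoid (≈-sym (%ℕ-≈ p z)) (+∈residues (z %ℕ p) (n%ℕd<d z p))

  Unique⇒↭residues : ∀ {xs} → Unique xs → length xs ≡ p → xs ↭ residues
  Unique⇒↭residues xs! |xs|≡p =
    Unique⇒↭ xs! (λ {x} _ → complete x) (ℕ.≤-reflexive (trans length-residues (sym |xs|≡p)))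

  -- Distinctness is clear for 0, ..., p - 1 and is carried over to the signed representatives,
  -- which are a reordering of these up to congruence.
  residues! : Unique residues
  residues! = Permutationₚ.Unique-resp-↭ ≈-setoid
    (Unique⇒↭residues (Uniqueₚ.applyUpTo⁺₁ ≈-setoid +_ p (+≉+ p)) (length-applyUpTo +_ p))
    (Uniqueₚ.applyUpTo⁺₁ ≈-setoid +_ p (+≉+ p))

  signed-half! : Unique (signed half)
  signed-half! = Uniqueₚ.drop⁺ ≈-setoid 1 residues!

  map-residues-↭ : ∀ {f} → (∀ {x y} → f x ≈ f y → x ≈ y) → map f residues ↭ residues
  map-residues-↭ {f} f-inj = Unique⇒↭residues (Uniqueₚ.map⁺ ≈-setoid ≈-setoid f-inj residues!)
    (trans (length-map f residues) length-residues)

  -- Inverses and Wilson's theorem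

  inverse : ∀ {x} → ¬ (x ≈ 0ℤ) → ∃ λ y → y ∈ₗ residues × x * y ≈ 1ℤ
  inverse {x} x≉0 =
    -- Multiplication by `x` is injective, hence permutes the residues, and so takes the value 1.
    let y , y∈ , 1≈yx = Membershipₚ.∈-map⁻ ≈-setoid ≈-setoid
          (Permutationₚ.∈-resp-↭ ≈-setoid
            (↭-sym (map-residues-↭ (λ {y} {z} → *-cancelʳ-≈ y z x x≉0))) (complete 1ℤ))
    in y , y∈ , ≈-trans (≈-reflexive (*-comm x y)) (≈-sym 1≈yx)

  -- Apart from ±1, no nonzero residue is its own inverse.
  paired : Paired (signed (applyUpTo (λ i → + suc (suc i)) m′))
  paired {x} x∈ =
    let y , y∈ , xy≈1 = inverse x≉0
    in  y , ∈-∷⁻ (y≉-1 xy≈1) (∈-∷⁻ (y≉1 xy≈1) (∈-∷⁻ (y≉0 xy≈1) y∈)) , xy≈1 , x≉y xy≈1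
    where
    x≉0 : ¬ (x ≈ 0ℤ)
    x≉0 = head-≉ residues! (there (there x∈)) ∘ ≈-sym
    x≉1 : ¬ (x ≈ 1ℤ)
    x≉1 = head-≉ signed-half! (there x∈) ∘ ≈-sym
    x≉-1 : ¬ (x ≈ -1ℤ)
    x≉-1 = head-≉ (Uniqueₚ.drop⁺ ≈-setoid 1 signed-half!) x∈ ∘ ≈-sym
    y≉0 : ∀ {y} → x * y ≈ 1ℤ → ¬ (y ≈ 0ℤ)
    y≉0 xy≈1 y≈0 = 1≉0 (≈-trans (≈-sym xy≈1) (≈-trans (*-congˡ x y≈0) (≈-reflexive (*-zeroʳ x))))
    y≉1 : ∀ {y} → x * y ≈ 1ℤ → ¬ (y ≈ 1ℤ)
    y≉1 xy≈1 y≈1 = x≉1 (inverse-unique {z = 1ℤ} (≈-trans (*-congˡ x (≈-sym y≈1)) xy≈1) ≈-refl)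
    y≉-1 : ∀ {y} → x * y ≈ 1ℤ → ¬ (y ≈ -1ℤ)
    y≉-1 xy≈1 y≈-1 = x≉-1 (inverse-unique {z = -1ℤ} (≈-trans (*-congˡ x (≈-sym y≈-1)) xy≈1) ≈-refl)
    x≉y : ∀ {y} → x * y ≈ 1ℤ → ¬ (x ≈ y)
    x≉y xy≈1 x≈y = Sum.[ x≉1 , x≉-1 ] (square-injective x 1ℤ (≈-trans (*-congˡ x x≈y) xy≈1))

  -- The list begins with 1 and -1, which give the factor -1; the remaining entries cancel in
  -- inverse pairs.
  wilson : prod (signed half) ≈ -1ℤ
  wilson = ≈-trans (≈-reflexive (sym (*-assoc 1ℤ -1ℤ _)))
    (*-congˡ -1ℤ (prod-paired _ ℕ.≤-refl (Uniqueₚ.drop⁺ ≈-setoid 2 signed-half!) paired))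

  -- The Vandermonde product of the d-th powers

  module _ (even : -1ℤ ^ m ≡ 1ℤ) where

    prod-half² : prod half * prod half ≈ -1ℤ
    prod-half² = begin
      prod half * prod half          ≡⟨ *-identityˡ _ ⟨
      1ℤ * (prod half * prod half)
        ≡⟨ cong (_* (prod half * prod half)) (trans (cong (-1ℤ ^_) length-half) even) ⟨
      -1ℤ ^ length half * (prod half * prod half)  ≡⟨ prod-signed half ⟨
      prod (signed half)             ≈⟨ wilson ⟩
      -1ℤ                            ∎

    -- As (m!)² is -1, the fourth power of m! is 1 and its cube is -m!.
    prod-half-^ : ∀ j → prod half ^ (3 ℕ.+ 4 ℕ.* j) ≈ - prod half
    prod-half-^ j = begin
      P ^ (3 ℕ.+ 4 ℕ.* j)  ≡⟨ ^-3+4* P j ⟩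
      P ^ 3 * (P ^ 4) ^ j  ≈⟨ *-cong P³≈-P (^-cong j P⁴≈1) ⟩
      - P * 1ℤ ^ j         ≡⟨ cong (- P *_) (^-zeroˡ j) ⟩
      - P * 1ℤ             ≡⟨ *-identityʳ (- P) ⟩
      - P                  ∎
      where
      P = prod half
      P³≈-P : P ^ 3 ≈ - P
      P³≈-P = begin
        P ^ 3        ≡⟨ cong (λ z → P * (P * z)) (*-identityʳ P) ⟩
        P * (P * P)  ≈⟨ *-congˡ P prod-half² ⟩
        P * -1ℤ      ≡⟨ trans (*-comm P -1ℤ) (-1*i≡-i P) ⟩
        - P          ∎
      P⁴≈1 : P ^ 4 ≈ 1ℤ
      P⁴≈1 = begin
        P * P ^ 3    ≈⟨ *-congˡ P P³≈-P ⟩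
        P * - P      ≡⟨ neg-distribʳ-* P P ⟨
        - (P * P)    ≈⟨ neg-cong prod-half² ⟩
        1ℤ           ∎

    -- The d-th powers again form a list 0, ±g₁, ..., ±gₘ, so `vandermonde-0∷signed` evaluates both
    -- sides. The sign comes from the cube of the product of the gᵢ, which is -m!.
    vandermonde-power : ∀ j → let d = 3 ℕ.+ 4 ℕ.* j in (∀ {x y} → x ^ d ≈ y ^ d → x ≈ y) →
      vandermonde (map (_^ d) residues) ≈ - vandermonde residues
    vandermonde-power j ^-inj = begin
      vandermonde (map (_^ d) residues)
        ≡⟨ cong vandermonde map≡ ⟩
      vandermonde (0ℤ ∷ signed G)
        ≡⟨ vandermonde-0∷signed G ⟩
      -1ℤ ^ length G * (+ 2) ^ length G * (prod G * prod G * prod G * discriminant (map square G))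
        ≡⟨ cong (λ l → -1ℤ ^ l * (+ 2) ^ l * (prod G * prod G * prod G * discriminant (map square G)))
             (length-map (_^ d) half) ⟩
      K * (prod G * prod G * prod G * discriminant (map square G))
        ≈⟨ *-congˡ K (*-cong (*-cong (*-cong prod-G prod-G) prod-G) (discriminant-resp-↭ squares-↭)) ⟩
      K * (- P * - P * - P * D)
        ≡⟨ pull-neg K P D ⟩
      - (K * (P * P * P * D))
        ≡⟨ cong -_ (vandermonde-0∷signed half) ⟨
      - vandermonde residues ∎
      where
      d = 3 ℕ.+ 4 ℕ.* j
      G = map (_^ d) half
      P = prod half
      D = discriminant (map square half)
      K = -1ℤ ^ length half * (+ 2) ^ length half
      pull-neg : ∀ K P D → K * (- P * - P * - P * D) ≡ - (K * (P * P * P * D))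
      pull-neg = solve-∀
      -- The head is settled by computation: `d` is visibly a successor, so 0 to the power `d`
      -- reduces to 0.
      map≡ : map (_^ d) residues ≡ 0ℤ ∷ signed G
      map≡ = cong (0ℤ ∷_) (map-signed (_^ d) (^-odd j) half)
      prod-G : prod G ≈ - P
      prod-G = ≈-trans (≈-reflexive (prod-map-^ d half)) (prod-half-^ j)
      0∷±G! : Unique (0ℤ ∷ signed G)
      0∷±G! = subst Unique map≡ (Uniqueₚ.map⁺ ≈-setoid ≈-setoid ^-inj residues!)
      -- Every g in `G` is nonzero, hence congruent to some ±i with i in `half`, so g² is among the
      -- squares i². The g² are distinct, and equal lengths do the rest.
      squares-↭ : map square G ↭ map square half
      squares-↭ = Unique⇒↭ (Unique-squares (Uniqueₚ.drop⁺ ≈-setoid 1 0∷±G!))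
        (λ u∈ → let g , g∈G , u≈g² = Membershipₚ.∈-map⁻ ≈-setoid ≈-setoid u∈ in
          Membershipₚ.∈-resp-≈ ≈-setoid (≈-sym u≈g²)
            (∈-signed⁻ (∈-∷⁻ (head-≉ 0∷±G! (proj₁ (∈-signed⁺ g∈G)) ∘ ≈-sym) (complete g))))
        (ℕ.≤-reflexive (trans (length-map square half)
          (sym (trans (length-map square G) (length-map (_^ d) half)))))

    vandermonde-power-≉ : ∀ j → let d = 3 ℕ.+ 4 ℕ.* j in (∀ {x y} → x ^ d ≈ y ^ d → x ≈ y) →
      ∀ {xs} → xs ↭ residues → ¬ (vandermonde (map (_^ d) xs) ≈ vandermonde xs)
    vandermonde-power-≉ j ^-inj {xs} xs↭ fixed =
      -- Comparing the two evaluations of the sign gives V ≡ -V, hence 2V ≡ 0, although neither 2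
      -- nor V vanishes modulo `p`.
      *-≉0 2≉0 V≉0 (begin
        + 2 * V      ≡⟨ double V ⟩
        V - - V      ≈⟨ -‿cong V≈-V ≈-refl ⟩
        - V - - V    ≡⟨ +-inverseʳ (- V) ⟩
        0ℤ           ∎)
      where
      d = 3 ℕ.+ 4 ℕ.* j
      V = vandermonde residues
      double : ∀ V → + 2 * V ≡ V - - V
      double = solve-∀
      V≉0 : ¬ (V ≈ 0ℤ)
      V≉0 = vandermonde-≉0 residues!
      2≉0 : ¬ (+ 2 ≈ 0ℤ)
      2≉0 2≈0 = +≉+ p {0} {2} (ℕ.s≤s ℕ.z≤n) 2<p (≈-sym 2≈0)
        where
        2<p : 2 ℕ.< p
        2<p = subst (2 ℕ.<_) (sym (trans p≡1+2m (cong (2 ℕ.+_) (ℕ.+-suc m′ m′))))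
          (ℕ.s≤s (ℕ.s≤s (ℕ.s≤s ℕ.z≤n)))
      V≈-V : V ≈ - V
      V≈-V = *-cancelʳ-≈ V (- V) V V≉0 (begin
        V * V
          ≡⟨ cong (λ ys → vandermonde ys * V) (map-id residues) ⟨
        vandermonde (map id residues) * V
          -- For the identity map the order-independent product is the squared Vandermonde product,
          -- so `xs` may replace `residues`; the power map below brings `residues` back.
          ≈⟨ vandermonde-*-resp-↭ {f = id} id xs↭ ⟨
        vandermonde (map id xs) * vandermonde xs
          ≡⟨ cong (λ ys → vandermonde ys * vandermonde xs) (map-id xs) ⟩
        vandermonde xs * vandermonde xs
          ≈⟨ *-cong fixed ≈-refl ⟨
        vandermonde (map (_^ d) xs) * vandermonde xs
          ≈⟨ vandermonde-*-resp-↭ (^-cong d) xs↭ ⟩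
        vandermonde (map (_^ d) residues) * V
          ≈⟨ *-cong (vandermonde-power j ^-inj) ≈-refl ⟩
        - V * V ∎)

-- From the cycle to an orbit indexed by the natural numbers

module _ (p : ℕ) .{{_ : ℕ.NonZero p}} where

  toℕ-mod : ∀ i → toℕ (i ℕ.mod p) ≡ i % p
  toℕ-mod i = toℕ-fromℕ< (ℕ.m%n<n i p)

  mod-cong : ∀ {i j} → i % p ≡ j % p → i ℕ.mod p ≡ j ℕ.mod p
  mod-cong {i} {j} eq = toℕ-injective (trans (toℕ-mod i) (trans eq (sym (toℕ-mod j))))

  -- Lets the cycle on `Fin p` be continued to a p-periodic sequence in which each step is a plain
  -- successor.
  suc-mod : ∀ i → suc (toℕ (i ℕ.mod p)) ℕ.mod p ≡ suc i ℕ.mod p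
  suc-mod i = mod-cong (begin
    suc (toℕ (i ℕ.mod p)) % p        ≡⟨ cong (λ k → suc k % p) (toℕ-mod i) ⟩
    suc (i % p) % p                  ≡⟨ ℕ.%-distribˡ-+ 1 (i % p) p ⟩
    (1 % p ℕ.+ i % p % p) % p        ≡⟨ cong (λ k → (1 % p ℕ.+ k) % p) (ℕ.m%n%n≡m%n i p) ⟩
    (1 % p ℕ.+ i % p) % p            ≡⟨ ℕ.%-distribˡ-+ 1 i p ⟨
    suc i % p                        ∎)
    where open ≡-Reasoning

theorem1p3 : (c : ℤ) (d : ℕ) → d ≥ 2 → d % 4 ≡ 3 →
    (p : ℕ) → Prime p → p % 4 ≡ 1 → p ∉ S d c
theorem1p3 c d _ d%4≡3 p _ p%4≡1 (p-prime , (f-inj , _) , a , a-inj , a-step , _) =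
  cases (p ℕ./ 4) (d ℕ./ 4)
    (trans (ℕ.m≡m%n+[m/n]*n p 4) (cong (ℕ._+ p ℕ./ 4 ℕ.* 4) p%4≡1))
    (trans (ℕ.m≡m%n+[m/n]*n d 4) (cong₂ ℕ._+_ d%4≡3 (ℕ.*-comm (d ℕ./ 4) 4)))
  where
  instance
    p≢0 : ℕ.NonZero p
    p≢0 = prime⇒nonZero p-prime
  open Congruence p

  b : ℕ → ℤ
  b i = + toℕ (a (i ℕ.mod p))

  step : ∀ i → b i ^ d + c ≈ b (suc i)
  step i = ≈-trans (≈-residue p (b i ^ d + c))
    (≈-reflexive (cong (+_ ∘ toℕ) (trans (a-step (i ℕ.mod p)) (cong a (suc-mod p i)))))

  closed : b p ≡ b 0
  closed = cong (+_ ∘ toℕ ∘ a) (mod-cong p (trans (ℕ.n%n≡0 p) (sym (ℕ.m<n⇒m%n≡m (ℕ.>-nonZero⁻¹ p)))))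

  b-distinct : ∀ {i j} → i ℕ.< j → j ℕ.< p → ¬ (b i ≈ b j)
  b-distinct {i} {j} i<j j<p bi≈bj = ℕ.<⇒≢ i<j (trans (sym (ℕ.m<n⇒m%n≡m (ℕ.<-trans i<j j<p)))
    (trans (trans (sym (toℕ-mod p i)) (trans (cong toℕ (a-inj (toℕ-≈-injective p bi≈bj))) (toℕ-mod p j)))
      (ℕ.m<n⇒m%n≡m j<p)))

  -- Translation by `c` is invertible, so the power map inherits injectivity from the induced map.
  ^-inj : ∀ {x y} → x ^ d ≈ y ^ d → x ≈ y
  ^-inj {x} {y} x^d≈y^d = begin
    x                     ≈⟨ ≈-residue p x ⟩
    + toℕ (residue p x)   ≡⟨ cong (+_ ∘ toℕ) (f-inj (toℕ-≈-injective p images)) ⟩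
    + toℕ (residue p y)   ≈⟨ ≈-residue p y ⟨
    y                     ∎
    where
    open ≈-Reasoning ≈-setoid
    image : ∀ z → z ^ d + c ≈ + toℕ (induced p (φ d c) (residue p z))
    image z = ≈-trans (+-cong (^-cong d (≈-residue p z)) (≈-refl {c}))
      (≈-residue p ((+ toℕ (residue p z)) ^ d + c))
    images = ≈-trans (≈-sym (image x)) (≈-trans (+-cong x^d≈y^d (≈-refl {c})) (image y))

  cases : ∀ k j → p ≡ 1 ℕ.+ k ℕ.* 4 → d ≡ 3 ℕ.+ 4 ℕ.* j → ⊥
  cases zero    j p≡1 _    = ¬prime[1] (subst Prime p≡1 p-prime)
  -- Two parities enter: m = 2(k + 1) is even, which gives (m!)² ≡ -1, and p - 1 = 2m is even, which
  -- allows the rotation of the orbit.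
  cases (suc k) j p≡  refl = vandermonde-power-≉ (-1^[n+n]≡1 (suc k)) j ^-inj
    (Unique⇒↭residues (Uniqueₚ.applyUpTo⁺₁ ≈-setoid b p b-distinct) (length-applyUpTo b p))
    (subst (λ n → vandermonde (map (_^ d) (applyUpTo b n)) ≈ vandermonde (applyUpTo b n)) (sym p≡1+2m)
      (vandermonde-orbit d c (m ℕ.+ m) b (-1^[n+n]≡1 m) step
        (trans (cong b (sym p≡1+2m)) closed)))
    where
    m = suc k ℕ.+ suc k
    p≡1+2m : p ≡ suc (m ℕ.+ m)
    p≡1+2m = trans p≡ (cong suc (quadruple (suc k)))
      where
      quadruple : ∀ k → k ℕ.* 4 ≡ (k ℕ.+ k) ℕ.+ (k ℕ.+ k)
      quadruple = ℕ-solver.solve-∀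
    open SignedResidues p-prime p≡1+2m using (Unique⇒↭residues; vandermonde-power-≉)
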